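{- Let $p$ be an odd prime, $q$ an odd positive integer, and $a\in(\mathbb{Z}/pq\mathbb{Z})^*$ such that $a\bmod p$ generates $(\mathbb{Z}/p\mathbb{Z})^*$ and $a^{(p-1)/2}\equiv-1\pmod{pq}$. Suppose $q$ has a prime divisor $\ell\ge5$ which is a Fermat prime (i.e. of the form $2^{2^m}+1$) and a prime divisor $\ell'\equiv3\pmod 4$. Then $|S_{pq}(a)\cap(S_{pq}(a)+1)|=0$.
   Context: $S_{pq}(a)=\{a^j:0\le j<p-1\}\subseteq\mathbb{Z}/pq\mathbb{Z}$ and $S+1=\{s+1:s\in S\}$. -}

module Defs where

open import Algebra.Bundles.Raw using (RawRing)
open import Algebra.Definitions using (Invertible)
import Algebra.Definitions.RawSemiring as RawSemiringDefinitions
open import Data.Fin using (Fin; toℕ)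
open import Data.Fin.Properties using (any?; _≟_)
open import Data.Fin.Subset using (Subset)
open import Data.Fin.Subset.Properties using (_∈?_)
open import Data.Nat as ℕ using (ℕ; NonZero)
open import Data.Nat.DivMod using (_mod_)
open import Data.Nat.Primality using (Prime)
open import Data.Nat.Properties using (m*n≢0)
open import Data.Product using (Σ; _×_; _,_; ∃-syntax)
open import Data.Sum using (_⊎_)
open import Data.Vec using (tabulate)
open import Level using (0ℓ)
open import Relation.Binary.PropositionalEquality using (_≡_)
open import Relation.Nullary using (does)
open import Relation.Nullary.Decidable using (_×-dec_)
open import Relation.Unary using (Pred; Decidable)

FermatPrime : ℕ → Set
FermatPrime ℓ = Prime ℓ × ∃[ m ] ℓ ≡ 2 ℕ.^ (2 ℕ.^ m) ℕ.+ 1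

⟪_⟫ : ∀ {n} {P : Pred (Fin n) 0ℓ} → Decidable P → Subset n
⟪ P? ⟫ = tabulate λ x → does (P? x)

-- Residues modulo n are represented by Fin n.
module ℤ/ (n : ℕ) .{{_ : NonZero n}} where

  rawRing : RawRing 0ℓ 0ℓ
  rawRing = record
    { Carrier = Fin n
    ; _≈_     = _≡_
    ; _+_     = λ x y → (toℕ x ℕ.+ toℕ y) mod n
    ; _*_     = λ x y → (toℕ x ℕ.* toℕ y) mod n
    ; -_      = λ x → (n ℕ.∸ toℕ x) mod n
    ; 0#      = 0 mod n
    ; 1#      = 1 mod n
    }

  open RawRing rawRing public
    using (_+_; _*_; -_; 0#; 1#; rawSemiring)
  open RawSemiringDefinitions rawSemiring public using (_^_)

  IsUnit : Fin n → Set
  IsUnit = Invertible _≡_ 1# _*_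

  -- g generates the group of units: g is a unit and every unit is an
  -- integer power of g.  The powers with exponent - k are those of the
  -- inverse g⁻¹.
  GeneratesUnits : Fin n → Set
  GeneratesUnits g = Σ (IsUnit g) λ (g⁻¹ , _) →
    ∀ x → IsUnit x → ∃[ k ] (x ≡ g ^ k ⊎ x ≡ g⁻¹ ^ k)

  infixl 8 _+1

  _+1 : Subset n → Subset n
  X +1 = ⟪ (λ x → any? λ s → s ∈? X ×-dec x ≟ s + 1#) ⟫

module _ (p q : ℕ) .{{_ : NonZero p}} .{{_ : NonZero q}} where

  open ℤ/ (p ℕ.* q) {{m*n≢0 p q}}

  -- The exponents 0 ≤ j < p - 1 are the elements of Fin (p ∸ 1).
  S : Fin (p ℕ.* q) → Subset (p ℕ.* q)
  S a = ⟪ (λ x → any? λ (j : Fin (p ℕ.∸ 1)) → x ≟ a ^ toℕ j) ⟫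

{-# OPTIONS --safe #-}

-- Put h = (p - 1) / 2, so aʰ = -1 modulo every divisor of q.
-- Modulo ℓ′ ≡ 3 (mod 4) the residue -1 is not a square, hence h is odd.
-- Modulo the Fermat prime ℓ, (-a)ʰ = 1 with h odd, while the order of -a
-- divides the power of two ℓ - 1; hence a = -1 modulo ℓ.  Every power of a
-- is then ±1 modulo ℓ, and two of them differ by 1 only if ℓ divides 1 or 3.

module Submission where

open import Defs
open import Algebra.Bundles using (CommutativeRing; CommutativeSemiring)
import Algebra.Properties.CommutativeSemiring.Binomial as Binomial
import Algebra.Properties.Ring as RingProperties
import Algebra.Properties.Semiring.Exp as Exp
import Algebra.Properties.Semiring.Mult as Mult
import Algebra.Properties.Semiring.Sum as Sum
open import Data.Fin as Fin using (Fin; toℕ; fromℕ; inject₁)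
open import Data.Fin.Properties using (any?; _≟_; toℕ-fromℕ; toℕ-fromℕ<; toℕ-inject₁; toℕ<n)
open import Data.Fin.Subset using (Subset; Empty; _∩_; ∣_∣; _∈_)
open import Data.Fin.Subset.Properties using (_∈?_; Empty-unique; ∣⊥∣≡0; x∈p∩q⁻)
open import Data.Nat as ℕ
  using (ℕ; zero; suc; NonZero; _∸_; _≥_; _<_; z<s; s<s; s≤s; _!)
open import Data.Nat.Combinatorics
  using (_C_; nCn≡1; nCk≡n!/k![n-k]!; k![n∸k]!∣n!)
open import Data.Nat.DivMod
  using (_/_; _%_; _mod_; m/n*n≡m; m%n<n; m%n≤n; m%n%n≡m%n; n%n≡0; m<n⇒m%n≡m;
         m≡m%n+[m/n]*n; %-distribˡ-+; %-distribˡ-*; m∣n⇒o%n%m≡o%m)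
open import Data.Nat.Divisibility
  using (_∣_; divides-refl; ∣⇒≤; ∣-trans; n∣m*n; m∣m*n; n∣m⇒m%n≡0)
open import Data.Nat.Primality using (Prime; euclidsLemma; prime⇒nonZero; ¬prime[1])
import Data.Nat.Properties as ℕₚ
open import Data.Nat.Properties using (m*n≢0)
open import Data.Product using (_×_; _,_; ∃-syntax)
open import Data.Sum using (_⊎_; inj₁; inj₂)
open import Data.Vec.Properties using ([]=⇒lookup; lookup∘tabulate)
open import Function using (_∘_)
open import Level using (0ℓ)
open import Relation.Binary.PropositionalEquality as ≡
  using (_≡_; refl; cong; cong₂; subst)
import Relation.Binary.Construct.On as On
open import Relation.Nullary using (¬_; yes; no; contradiction)
open import Relation.Nullary.Decidable using (_×-dec_)
open import Relation.Unary using (Pred; Decidable)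

-- Elimination rules for membership in decidable subsets.

∈⟪⟫⁻ : ∀ {n} {P : Pred (Fin n) 0ℓ} (P? : Decidable P) {x} → x ∈ ⟪ P? ⟫ → P x
-- The equation `does (P? x) ≡ true` is abstracted together with `P? x`, so in the `no` case it
-- becomes absurd.
∈⟪⟫⁻ P? {x} x∈ with P? x | ≡.trans (≡.sym (lookup∘tabulate _ x)) ([]=⇒lookup x∈)
... | yes Px | _ = Px
... | no  _  | ()

∈-+1⁻ : ∀ {n} .{{_ : NonZero n}} (X : Subset n) {x} → let open ℤ/ n in
        x ∈ X +1 → ∃[ s ] (s ∈ X × x ≡ s + 1#)
∈-+1⁻ {n} X = ∈⟪⟫⁻ λ x → any? λ s → s ∈? X ×-dec x ≟ s + 1#
  where open ℤ/ n

∈S⁻ : ∀ p q .{{_ : NonZero p}} .{{_ : NonZero q}} a {x} →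
      let open ℤ/ (p ℕ.* q) {{m*n≢0 p q}} in
      x ∈ S p q a → ∃[ j ] x ≡ a ^ toℕ {p ∸ 1} j
∈S⁻ p q a = ∈⟪⟫⁻ λ x → any? λ (j : Fin (p ∸ 1)) → x ≟ a ^ toℕ j
  where open ℤ/ (p ℕ.* q) {{m*n≢0 p q}}

-- Parity, and primes dividing binomial coefficients.

even∨odd : ∀ n → ∃[ r ] (n ≡ 2 ℕ.* r ⊎ n ≡ 1 ℕ.+ 2 ℕ.* r)
even∨odd zero    = 0 , inj₁ refl
even∨odd (suc n) with even∨odd n
... | r , inj₁ n≡2r   = r , inj₂ (cong suc n≡2r)
... | r , inj₂ n≡1+2r = suc r , inj₁ (≡.trans (cong suc n≡1+2r) (≡.sym (ℕₚ.*-suc 2 r)))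

-- By Euclid's lemma `p` would divide 1 or one of the factors of `k !`, all of which are positive
-- and smaller than `p`.
prime∤! : ∀ {p} → Prime p → ∀ {k} → k < p → ¬ p ∣ k !
prime∤! {p} p-prime {zero} _ p∣1 with ∣⇒≤ p∣1
... | s≤s {zero} _ = ¬prime[1] p-prime
prime∤! p-prime {suc k} k<p p∣k! with euclidsLemma (suc k) (k !) p-prime p∣k!
... | inj₁ p∣1+k = ℕₚ.<⇒≱ k<p (∣⇒≤ p∣1+k)
... | inj₂ p∣k!′ = prime∤! p-prime (ℕₚ.<-trans (ℕₚ.n<1+n k) k<p) p∣k!′

-- With `p = suc n` and `j = suc k`, the bound `k < n` says 0 < j < p. The prime `p` divides `p !`,
-- which is `p C j` times `j ! * (p ∸ j) !`, and it divides neither factorial, so it must divide the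
-- coefficient.
prime∣C : ∀ {n} → Prime (suc n) → ∀ {k} → k < n → suc n ∣ suc n C suc k
prime∣C {n} p-prime {k} k<n with euclidsLemma (p C j) (j ! ℕ.* (p ∸ j) !) p-prime
  (subst (p ∣_) (≡.sym C*[j!*[p∸j]!]≡p!) (m∣m*n (n !)))
  where
  p = suc n
  j = suc k
  j≤p = s≤s (ℕₚ.<⇒≤ k<n)
  instance _ = ℕₚ.m*n≢0 (j !) ((p ∸ j) !) {{j ℕₚ.!≢0}} {{(p ∸ j) ℕₚ.!≢0}}
  C*[j!*[p∸j]!]≡p! : (p C j) ℕ.* (j ! ℕ.* (p ∸ j) !) ≡ p !
  C*[j!*[p∸j]!]≡p! = ≡.trans
    (cong (ℕ._* (j ! ℕ.* (p ∸ j) !)) (nCk≡n!/k![n-k]! j≤p))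
    (m/n*n≡m (k![n∸k]!∣n! j≤p))
... | inj₁ p∣C = p∣C
... | inj₂ p∣j!*[p∸j]! with euclidsLemma (suc k !) ((n ∸ k) !) p-prime p∣j!*[p∸j]!
...   | inj₁ p∣ = contradiction p∣ (prime∤! p-prime (s<s k<n))
...   | inj₂ p∣ = contradiction p∣ (prime∤! p-prime (s≤s (ℕₚ.m∸n≤m n k)))

-- The Frobenius map in characteristic p.

module _ {c ℓ} (R : CommutativeSemiring c ℓ) where

  open CommutativeSemiring R hiding (refl)
  open Binomial R using (binomialTerm; theorem)
  open Exp semiring
  open Mult semiring using (×-congˡ; ×-homo-1; ×-assocˡ) renaming (_×_ to _·_)
  open Sum semiring
  open import Relation.Binary.Reasoning.Setoid setoid

  ∣⇒·≈0 : ∀ {m n} → (∀ x → m · x ≈ 0#) → m ∣ n → ∀ x → n · x ≈ 0#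
  ∣⇒·≈0 {m} m·≈0 (divides-refl q) x = begin
    (q ℕ.* m) · x ≡⟨ cong (_· x) (ℕₚ.*-comm q m) ⟩
    (m ℕ.* q) · x ≈⟨ ×-assocˡ x m q ⟨
    m · (q · x)   ≈⟨ m·≈0 (q · x) ⟩
    0#            ∎

  -- In the binomial expansion every term strictly between the two ends has a coefficient divisible
  -- by `p`, hence vanishes.
  freshman's-dream : ∀ {p} → Prime p → (∀ x → p · x ≈ 0#) →
                     ∀ x y → (x + y) ^ p ≈ x ^ p + y ^ p
  freshman's-dream {suc n} p-prime p·≈0 x y = begin
    (x + y) ^ p                              ≈⟨ theorem p x y ⟩
    -- The index of a term is the exponent of `x`, so index zero contributes `y ^ p` and the last
    -- index `x ^ p`.
    t Fin.zero + sum (t ∘ Fin.suc)           ≈⟨ +-congˡ (sum-init-last (t ∘ Fin.suc)) ⟩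
    t Fin.zero + (sum middle + t (fromℕ p))  ≈⟨ +-cong first (+-cong middle≈0 last′) ⟩
    y ^ p + (0# + x ^ p)                     ≈⟨ +-congˡ (+-identityˡ (x ^ p)) ⟩
    y ^ p + x ^ p                            ≈⟨ +-comm (y ^ p) (x ^ p) ⟩
    x ^ p + y ^ p                            ∎
    where
    p = suc n
    t = binomialTerm x y p

    middle : Fin n → Carrier
    middle i = t (Fin.suc (inject₁ i))

    first : t Fin.zero ≈ y ^ p
    first = trans (×-homo-1 _) (*-identityˡ (y ^ p))

    last′ : t (fromℕ p) ≈ x ^ p
    last′ rewrite toℕ-fromℕ n = begin
      (p C p) · (x ^ p * y ^ (p ∸ p)) ≈⟨ ×-congˡ (nCn≡1 p) ⟩
      1 · (x ^ p * y ^ (p ∸ p))       ≈⟨ ×-homo-1 _ ⟩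
      x ^ p * y ^ (p ∸ p)             ≈⟨ *-congˡ (^-congʳ y (ℕₚ.n∸n≡0 p)) ⟩
      x ^ p * 1#                      ≈⟨ *-identityʳ (x ^ p) ⟩
      x ^ p                           ∎

    middle≈0 : sum middle ≈ 0#
    middle≈0 = trans (sum-cong-≋ vanish) (sum-replicate-zero n)
      where
      vanish : ∀ i → middle i ≈ 0#
      vanish i = ∣⇒·≈0 p·≈0 (prime∣C p-prime i<n) _
        where i<n = subst (_< n) (≡.sym (toℕ-inject₁ i)) (toℕ<n i)

-- Powers, signs and square roots of -1 in commutative rings.

module _ {c ℓ} (R : CommutativeRing c ℓ) where

  open CommutativeRing R hiding (refl)
  open Exp semiring
  open RingProperties ring
  open import Relation.Binary.Reasoning.Setoid setoid

  1^n≈1 : ∀ n → 1# ^ n ≈ 1#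
  1^n≈1 zero    = CommutativeRing.refl R
  1^n≈1 (suc n) = trans (*-identityˡ _) (1^n≈1 n)

  x²≈1⇒x^[1+2r]≈x : ∀ {x} → x ^ 2 ≈ 1# → ∀ r → x ^ (1 ℕ.+ 2 ℕ.* r) ≈ x
  x²≈1⇒x^[1+2r]≈x {x} x²≈1 r = begin
    x * x ^ (2 ℕ.* r) ≈⟨ *-congˡ (^-assocʳ x 2 r) ⟨
    x * (x ^ 2) ^ r   ≈⟨ *-congˡ (^-congˡ r x²≈1) ⟩
    x * 1# ^ r        ≈⟨ *-congˡ (1^n≈1 r) ⟩
    x * 1#            ≈⟨ *-identityʳ x ⟩
    x                 ∎

  ^2-comm : ∀ x n → (x ^ 2) ^ n ≈ (x ^ n) ^ 2
  ^2-comm x n = begin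
    (x ^ 2) ^ n   ≈⟨ ^-assocʳ x 2 n ⟩
    x ^ (2 ℕ.* n) ≡⟨ cong (x ^_) (ℕₚ.*-comm 2 n) ⟩
    x ^ (n ℕ.* 2) ≈⟨ ^-assocʳ x n 2 ⟨
    (x ^ n) ^ 2   ∎

  -- The order of `x` would divide two coprime numbers. Concretely, induction on `k` applied to
  -- `x ^ 2` gives `x ^ 2 ≈ 1#`, and then the odd power of `x` is `x` itself.
  odd∧2-power-order⇒1 : ∀ k r {x} → x ^ (2 ℕ.^ k) ≈ 1# → x ^ (1 ℕ.+ 2 ℕ.* r) ≈ 1# → x ≈ 1#
  odd∧2-power-order⇒1 zero    r {x} x¹≈1 _ = trans (sym (*-identityʳ x)) x¹≈1
  odd∧2-power-order⇒1 (suc k) r {x} x^2^≈1 x^odd≈1 =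
    trans (sym (x²≈1⇒x^[1+2r]≈x x²≈1 r)) x^odd≈1
    where
    x²≈1 : x ^ 2 ≈ 1#
    x²≈1 = odd∧2-power-order⇒1 k r
      (trans (^-assocʳ x 2 (2 ℕ.^ k)) x^2^≈1)
      (trans (^2-comm x (1 ℕ.+ 2 ℕ.* r)) (trans (^-congˡ 2 x^odd≈1) (1^n≈1 2)))

  -- Turns the form of Fermat's theorem valid for every residue into the one valid for units, by
  -- multiplying with the inverse `y`.
  invertible⇒cancel-^ : ∀ {x y} n → x * y ≈ 1# → x ^ suc n ≈ x → x ^ n ≈ 1#
  invertible⇒cancel-^ {x} {y} n xy≈1 x^[1+n]≈x = begin
    x ^ n           ≈⟨ *-identityˡ _ ⟨
    1# * x ^ n      ≈⟨ *-congʳ (trans (*-comm y x) xy≈1) ⟨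
    y * x * x ^ n   ≈⟨ *-assoc y x (x ^ n) ⟩
    y * x ^ suc n   ≈⟨ *-congˡ x^[1+n]≈x ⟩
    y * x           ≈⟨ *-comm y x ⟩
    x * y           ≈⟨ xy≈1 ⟩
    1#              ∎

  -x*-x≈x*x : ∀ x → - x * - x ≈ x * x
  -x*-x≈x*x x = begin
    - x * - x     ≈⟨ -‿distribˡ-* x (- x) ⟨
    - (x * - x)   ≈⟨ -‿cong (-‿distribʳ-* x x) ⟨
    - - (x * x)   ≈⟨ -‿involutive (x * x) ⟩
    x * x         ∎

  [-x]^odd : ∀ x r → (- x) ^ (1 ℕ.+ 2 ℕ.* r) ≈ - (x ^ (1 ℕ.+ 2 ℕ.* r))
  [-x]^odd x r = begin
    - x * (- x) ^ (2 ℕ.* r)   ≈⟨ *-congˡ (^-assocʳ (- x) 2 r) ⟨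
    - x * ((- x) ^ 2) ^ r     ≈⟨ *-congˡ (^-congˡ r [-x]²≈x²) ⟩
    - x * (x ^ 2) ^ r         ≈⟨ *-congˡ (^-assocʳ x 2 r) ⟩
    - x * x ^ (2 ℕ.* r)       ≈⟨ -‿distribˡ-* x _ ⟨
    - (x ^ (1 ℕ.+ 2 ℕ.* r))   ∎
    where
    [-x]²≈x² : (- x) ^ 2 ≈ x ^ 2
    [-x]²≈x² = begin
      - x * (- x * 1#) ≈⟨ *-congˡ (*-identityʳ (- x)) ⟩
      - x * - x        ≈⟨ -x*-x≈x*x x ⟩
      x * x            ≈⟨ *-congˡ (*-identityʳ x) ⟨
      x ^ 2            ∎

  -- An odd power of `- x` is 1, and by `fermat` so is its power with exponent `2 ^ k`. The
  -- exponents are coprime, so `- x` is 1.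
  x^odd≈-1⇒x≈-1 : ∀ k r x → (- x) ^ suc (2 ℕ.^ k) ≈ - x →
                  x ^ (1 ℕ.+ 2 ℕ.* r) ≈ - 1# → x ≈ - 1#
  x^odd≈-1⇒x≈-1 k r x fermat x^odd≈-1 = begin
    x     ≈⟨ -‿involutive x ⟨
    - - x ≈⟨ -‿cong (odd∧2-power-order⇒1 k r -x^2^≈1 -x^odd≈1) ⟩
    - 1#  ∎
    where
    -x^odd≈1 : (- x) ^ (1 ℕ.+ 2 ℕ.* r) ≈ 1#
    -x^odd≈1 = trans ([-x]^odd x r) (trans (-‿cong x^odd≈-1) (-‿involutive 1#))
    -- Read as `- x * (- x) ^ (2 ℕ.* r) ≈ 1#`, the equation `-x^odd≈1` supplies the inverse of
    -- `- x`.
    -x^2^≈1 = invertible⇒cancel-^ (2 ℕ.^ k) -x^odd≈1 fermat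

  -- Since `y ^ 4 ≈ 1#`, the exponent in `fermat` may be lowered to 3. Then 1 = y * y³ = y * y = -1.
  √-1⇒2≈0 : ∀ s y → y ^ (3 ℕ.+ 4 ℕ.* s) ≈ y → y ^ 2 ≈ - 1# → 1# + 1# ≈ 0#
  √-1⇒2≈0 s y fermat y²≈-1 = begin
    1# + 1#       ≈⟨ +-congʳ 1≈-1 ⟩
    - 1# + 1#     ≈⟨ -‿inverseˡ 1# ⟩
    0#            ∎
    where
    y⁴≈1 : y ^ 4 ≈ 1#
    y⁴≈1 = begin
      y ^ 4         ≈⟨ ^-homo-* y 2 2 ⟩
      y ^ 2 * y ^ 2 ≈⟨ *-cong y²≈-1 y²≈-1 ⟩
      - 1# * - 1#   ≈⟨ -x*-x≈x*x 1# ⟩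
      1# * 1#       ≈⟨ *-identityˡ 1# ⟩
      1#            ∎

    y³≈y : y ^ 3 ≈ y
    y³≈y = begin
      y ^ 3                   ≈⟨ *-identityʳ _ ⟨
      y ^ 3 * 1#              ≈⟨ *-congˡ (1^n≈1 s) ⟨
      y ^ 3 * 1# ^ s          ≈⟨ *-congˡ (^-congˡ s y⁴≈1) ⟨
      y ^ 3 * (y ^ 4) ^ s     ≈⟨ *-congˡ (^-assocʳ y 4 s) ⟩
      y ^ 3 * y ^ (4 ℕ.* s)   ≈⟨ ^-homo-* y 3 (4 ℕ.* s) ⟨
      y ^ (3 ℕ.+ 4 ℕ.* s)     ≈⟨ fermat ⟩
      y                       ∎

    1≈-1 : 1# ≈ - 1#
    1≈-1 = begin
      1#            ≈⟨ y⁴≈1 ⟨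
      y * y ^ 3     ≈⟨ *-congˡ y³≈y ⟩
      y * y         ≈⟨ *-congˡ (*-identityʳ y) ⟨
      y ^ 2         ≈⟨ y²≈-1 ⟩
      - 1#          ∎

  -1^n≈±1 : ∀ {x} → x ≈ - 1# → ∀ n → x ^ n ≈ 1# ⊎ x ^ n ≈ - 1#
  -1^n≈±1 x≈-1 zero    = inj₁ (CommutativeRing.refl R)
  -1^n≈±1 {x} x≈-1 (suc n) with -1^n≈±1 x≈-1 n
  ... | inj₁ x^n≈1  = inj₂ (trans (*-cong x≈-1 x^n≈1) (*-identityʳ (- 1#)))
  ... | inj₂ x^n≈-1 = inj₁ (begin
    x * x ^ n   ≈⟨ *-cong x≈-1 x^n≈-1 ⟩
    - 1# * - 1# ≈⟨ -x*-x≈x*x 1# ⟩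
    1# * 1#     ≈⟨ *-identityˡ 1# ⟩
    1#          ∎)

  -1≈x⇒1+x≈0 : ∀ {x} → - 1# ≈ x → 1# + x ≈ 0#
  -1≈x⇒1+x≈0 {x} -1≈x = trans (+-congˡ (sym -1≈x)) (-‿inverseʳ 1#)

  1≈0⇒3≈0 : 1# ≈ 0# → 1# + (1# + 1#) ≈ 0#
  1≈0⇒3≈0 1≈0 = begin
    1# + (1# + 1#) ≈⟨ +-cong 1≈0 (+-cong 1≈0 1≈0) ⟩
    0# + (0# + 0#) ≈⟨ +-identityˡ _ ⟩
    0# + 0#        ≈⟨ +-identityˡ 0# ⟩
    0#             ∎

  -- Only the signs `x = -1`, `y = 1` yield 3 = 0 directly. The other three cases collapse the ring
  -- to 1 = 0, which is weakened to 3 = 0 so that one conclusion covers all four.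
  ±1≈±1+1⇒3≈0 : ∀ {x y} → x ≈ 1# ⊎ x ≈ - 1# → y ≈ 1# ⊎ y ≈ - 1# → x ≈ y + 1# →
                1# + (1# + 1#) ≈ 0#
  ±1≈±1+1⇒3≈0 {x} {y} (inj₁ x≈1) (inj₁ y≈1) x≈y+1 =
    1≈0⇒3≈0 (sym (+-cancelˡ 1# 0# 1# (begin
      1# + 0# ≈⟨ +-identityʳ 1# ⟩
      1#      ≈⟨ x≈1 ⟨
      x       ≈⟨ x≈y+1 ⟩
      y + 1#  ≈⟨ +-congʳ y≈1 ⟩
      1# + 1# ∎)))
  ±1≈±1+1⇒3≈0 {x} {y} (inj₁ x≈1) (inj₂ y≈-1) x≈y+1 = 1≈0⇒3≈0 (begin
      1#        ≈⟨ x≈1 ⟨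
      x         ≈⟨ x≈y+1 ⟩
      y + 1#    ≈⟨ +-congʳ y≈-1 ⟩
      - 1# + 1# ≈⟨ -‿inverseˡ 1# ⟩
      0#        ∎)
  ±1≈±1+1⇒3≈0 (inj₂ x≈-1) (inj₁ y≈1) x≈y+1 =
    -1≈x⇒1+x≈0 (trans (sym x≈-1) (trans x≈y+1 (+-congʳ y≈1)))
  ±1≈±1+1⇒3≈0 {x} {y} (inj₂ x≈-1) (inj₂ y≈-1) x≈y+1 = 1≈0⇒3≈0 (begin
      1#        ≈⟨ -‿involutive 1# ⟨
      - - 1#    ≈⟨ -‿cong (begin
        - 1#      ≈⟨ x≈-1 ⟨
        x         ≈⟨ x≈y+1 ⟩
        y + 1#    ≈⟨ +-congʳ y≈-1 ⟩
        - 1# + 1# ≈⟨ -‿inverseˡ 1# ⟩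
        0#        ∎) ⟩
      - 0#      ≈⟨ -0#≈0# ⟩
      0#        ∎)

open import Data.Nat using (_*_)

-- Residues modulo n and Fermat's little theorem.

module Modulo (n : ℕ) .{{_ : NonZero n}} where

  infix 4 _≈_

  _≈_ : ℕ → ℕ → Set
  x ≈ y = x % n ≡ y % n

  +-cong : ∀ {x y u v} → x ≈ y → u ≈ v → x ℕ.+ u ≈ y ℕ.+ v
  +-cong {x} {y} {u} {v} x≈y u≈v = begin
    (x ℕ.+ u) % n         ≡⟨ %-distribˡ-+ x u n ⟩
    (x % n ℕ.+ u % n) % n ≡⟨ cong₂ (λ i j → (i ℕ.+ j) % n) x≈y u≈v ⟩
    (y % n ℕ.+ v % n) % n ≡⟨ %-distribˡ-+ y v n ⟨
    (y ℕ.+ v) % n         ∎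
    where open ≡.≡-Reasoning

  *-cong : ∀ {x y u v} → x ≈ y → u ≈ v → x * u ≈ y * v
  *-cong {x} {y} {u} {v} x≈y u≈v = begin
    (x * u) % n           ≡⟨ %-distribˡ-* x u n ⟩
    (x % n * (u % n)) % n ≡⟨ cong₂ (λ i j → (i * j) % n) x≈y u≈v ⟩
    (y % n * (v % n)) % n ≡⟨ %-distribˡ-* y v n ⟨
    (y * v) % n           ∎
    where open ≡.≡-Reasoning

  -- Reducing `x` first keeps the truncated subtraction exact and makes `neg x` depend on the
  -- residue alone, so that it respects `_≈_`.
  neg : ℕ → ℕ
  neg x = n ∸ x % n

  neg-inverseˡ : ∀ x → neg x ℕ.+ x ≈ 0
  neg-inverseˡ x = begin
    (neg x ℕ.+ x) % n     ≡⟨ +-cong {neg x} refl (m%n%n≡m%n x n) ⟨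
    (neg x ℕ.+ x % n) % n ≡⟨ cong (_% n) (ℕₚ.m∸n+n≡m (m%n≤n x n)) ⟩
    n % n                 ≡⟨ n%n≡0 n ⟩
    0                     ≡⟨ m<n⇒m%n≡m (ℕ.>-nonZero⁻¹ n) ⟨
    0 % n                 ∎
    where open ≡.≡-Reasoning

  -- The carrier is ℕ with congruence as its equality, so most ring laws are inherited from ℕ, and
  -- induction on a representative stays available.
  ring : CommutativeRing 0ℓ 0ℓ
  ring = record
    { Carrier = ℕ
    ; _≈_ = _≈_
    ; _+_ = ℕ._+_
    ; _*_ = _*_
    ; -_  = neg
    ; 0#  = 0
    ; 1#  = 1
    ; isCommutativeRing = record
      { isRing = record
        { +-isAbelianGroup = record
          { isGroup = record
            { isMonoid = record
              { isSemigroup = record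
                { isMagma = record
                  { isEquivalence = On.isEquivalence (_% n) ≡.isEquivalence
                  ; ∙-cong = λ {x} {y} {u} {v} → +-cong {x} {y} {u} {v}
                  }
                ; assoc = λ x y z → cong (_% n) (ℕₚ.+-assoc x y z)
                }
              ; identity = (λ x → refl) , λ x → cong (_% n) (ℕₚ.+-identityʳ x)
              }
            ; inverse = neg-inverseˡ , λ x →
                ≡.trans (cong (_% n) (ℕₚ.+-comm x (neg x))) (neg-inverseˡ x)
            ; ⁻¹-cong = cong (λ r → (n ∸ r) % n)
            }
          ; comm = λ x y → cong (_% n) (ℕₚ.+-comm x y)
          }
        ; *-cong = λ {x} {y} {u} {v} → *-cong {x} {y} {u} {v}
        ; *-assoc = λ x y z → cong (_% n) (ℕₚ.*-assoc x y z)
        ; *-identity = (λ x → cong (_% n) (ℕₚ.*-identityˡ x)) ,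
                       (λ x → cong (_% n) (ℕₚ.*-identityʳ x))
        ; distrib = (λ x y z → cong (_% n) (ℕₚ.*-distribˡ-+ x y z)) ,
                    (λ x y z → cong (_% n) (ℕₚ.*-distribʳ-+ x y z))
        }
      ; *-comm = λ x y → cong (_% n) (ℕₚ.*-comm x y)
      }
    }

  open CommutativeRing ring public using (semiring; commutativeSemiring; 1#; -_)
  open Exp semiring public using (_^_)
  open Mult semiring using () renaming (_×_ to _·_)

  ·≡* : ∀ m x → m · x ≡ m * x
  ·≡* zero    x = refl
  ·≡* (suc m) x = cong (x ℕ.+_) (·≡* m x)

  -- Induction on the representative: `(1 + x) ^ n` is congruent to `1 + x ^ n` by the Frobenius
  -- identity.
  fermat : Prime n → ∀ x → x ^ n ≈ x
  fermat n-prime zero    = zero-power n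
    where
    zero-power : ∀ m .{{_ : NonZero m}} → 0 ^ m ≈ 0
    zero-power (suc m) = refl
  fermat n-prime (suc x) = begin
    (1 ℕ.+ x) ^ n % n     ≡⟨ freshman's-dream commutativeSemiring n-prime n·≈0 1 x ⟩
    (1 ^ n ℕ.+ x ^ n) % n ≡⟨ +-cong {1 ^ n} (1^n≈1 ring n) (fermat n-prime x) ⟩
    (1 ℕ.+ x) % n         ∎
    where
    open ≡.≡-Reasoning
    n·≈0 : ∀ x → n · x ≈ 0
    n·≈0 x = ≡.trans (cong (_% n) (·≡* n x))
      (≡.trans (n∣m⇒m%n≡0 (n * x) n (m∣m*n x)) (≡.sym (m<n⇒m%n≡m (ℕ.>-nonZero⁻¹ n))))

  ≉0 : ∀ {x} .{{_ : NonZero x}} → x < n → ¬ x ≈ 0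
  ≉0 {x} x<n x≈0 = ℕ.≢-nonZero⁻¹ x
    (≡.trans (≡.sym (m<n⇒m%n≡m x<n)) (≡.trans x≈0 (m<n⇒m%n≡m (ℕₚ.≤-<-trans ℕ.z≤n x<n))))

  -- Reduction from ℤ/N to a divisor n of N.

  module Reduction (N : ℕ) .{{_ : NonZero N}} (n∣N : n ∣ N) where

    private module N = ℤ/ N

    -- Reducing modulo `N` changes a number by a multiple of `N`, which `n` divides. Hence `toℕ`
    -- carries the operations of ℤ/N to those modulo `n`.
    toℕ-mod : ∀ x → toℕ (x mod N) ≈ x
    toℕ-mod x = ≡.trans (cong (_% n) (toℕ-fromℕ< (m%n<n x N))) (m∣n⇒o%n%m≡o%m n N x n∣N)

    toℕ-^ : ∀ x k → toℕ (x N.^ k) ≈ toℕ x ^ k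
    toℕ-^ x zero    = toℕ-mod 1
    toℕ-^ x (suc k) = ≡.trans (toℕ-mod _) (*-cong {toℕ x} refl (toℕ-^ x k))

    toℕ-+1 : ∀ x → toℕ (x N.+ N.1#) ≈ toℕ x ℕ.+ 1
    toℕ-+1 x = ≡.trans (toℕ-mod _) (+-cong {toℕ x} refl (toℕ-mod 1))

    -- The two negations subtract from different moduli, so they are compared through uniqueness of
    -- additive inverses: adding 1 gives `N`, which is 0 modulo `n`.
    toℕ-[-1] : toℕ (N.- N.1#) ≈ - 1#
    toℕ-[-1] = +-inverse-unique (begin
      -- `N.- N.1#` unfolds to `(N ∸ u) mod N`, so the summand 1 is traded for `u` to make the
      -- subtraction cancel.
      (toℕ (N.- N.1#) ℕ.+ 1) % n            ≡⟨ +-cong (toℕ-mod (N ∸ u)) (≡.sym (toℕ-mod 1)) ⟩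
      (N ∸ u ℕ.+ u) % n                     ≡⟨ cong (_% n) (ℕₚ.m∸n+n≡m (ℕₚ.<⇒≤ (toℕ<n N.1#))) ⟩
      N % n                                 ≡⟨ n∣m⇒m%n≡0 N n n∣N ⟩
      0                                     ≡⟨ m<n⇒m%n≡m (ℕ.>-nonZero⁻¹ n) ⟨
      0 % n                                 ∎)
      where
      open ≡.≡-Reasoning
      u = toℕ N.1#
      open RingProperties (CommutativeRing.ring ring) using (+-inverseˡ-unique)
      +-inverse-unique = +-inverseˡ-unique (toℕ (N.- N.1#)) 1

-- The two prime divisors of q and the conclusion.

-1-nonsquare : ∀ {ℓ} .{{_ : NonZero ℓ}} → Prime ℓ → ℓ % 4 ≡ 3 →
               let open Modulo ℓ in ∀ y → ¬ y ^ 2 ≈ - 1#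
-1-nonsquare {ℓ} ℓ-prime ℓ%4≡3 y y²≈-1 =
  -- Writing `ℓ` as 3 + 4s with `s = ℓ / 4` puts Fermat's theorem in the required shape; the
  -- resulting 2 = 0 is impossible as 2 < ℓ.
  ≉0 2<ℓ (√-1⇒2≈0 ring (ℓ / 4) y
    (≡.trans (cong (λ i → y ^ i % ℓ) (≡.sym ℓ≡3+4s)) (fermat ℓ-prime y)) y²≈-1)
  where
  open Modulo ℓ
  ℓ≡3+4s : ℓ ≡ 3 ℕ.+ 4 * (ℓ / 4)
  ℓ≡3+4s = ≡.trans (m≡m%n+[m/n]*n ℓ 4) (cong₂ ℕ._+_ ℓ%4≡3 (ℕₚ.*-comm (ℓ / 4) 4))
  2<ℓ : 2 < ℓ
  2<ℓ = subst (2 <_) (≡.sym ℓ≡3+4s) (s<s (s<s z<s))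

mainTheorem10 : (p q : ℕ) .{{_ : NonZero p}} .{{_ : NonZero q}} (a : Fin (p * q)) →
    let open ℤ/ (p * q) {{m*n≢0 p q}} in
    Prime p → p % 2 ≡ 1 → q % 2 ≡ 1 →
    IsUnit a →
    ℤ/.GeneratesUnits p (toℕ a mod p) →
    a ^ ((p ∸ 1) / 2) ≡ - 1# →
    ∃[ ℓ ] (FermatPrime ℓ × ℓ ≥ 5 × ℓ ∣ q) →
    ∃[ ℓ′ ] (Prime ℓ′ × ℓ′ % 4 ≡ 3 × ℓ′ ∣ q) →
    ∣ S p q a ∩ S p q a +1 ∣ ≡ 0
mainTheorem10 p q a _ _ _ _ _ aʰ≡-1
  (ℓ , (ℓ-prime , m , ℓ≡2^2^m+1) , ℓ≥5 , ℓ∣q) (ℓ′ , ℓ′-prime , ℓ′%4≡3 , ℓ′∣q) =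
  ≡.trans (cong ∣_∣ (Empty-unique empty)) (∣⊥∣≡0 (p * q))
  where
  instance
    _ = m*n≢0 p q
    _ = prime⇒nonZero ℓ-prime
    _ = prime⇒nonZero ℓ′-prime

  h = (p ∸ 1) / 2
  x = toℕ a
  module ℤ/pq = ℤ/ (p * q)

  reduce : ∀ d .{{_ : NonZero d}} → d ∣ q → let open Modulo d in x ^ h ≈ - 1#
  reduce d d∣q = ≡.trans (≡.sym (toℕ-^ a h)) (≡.trans (cong (λ z → toℕ z % d) aʰ≡-1) toℕ-[-1])
    where
    open Modulo d
    open Reduction (p * q) (∣-trans d∣q (n∣m*n p))

  open Modulo ℓ
  open Reduction (p * q) (∣-trans ℓ∣q (n∣m*n p))

  x≈-1 : x ≈ - 1#
  x≈-1 with even∨odd h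
  -- For even `h`, the residue -1 would be the square of `x ^ r` modulo `ℓ′`.
  ... | r , inj₁ h≡2r = contradiction
    (≡.trans (Exp.^-assocʳ (Modulo.semiring ℓ′) x r 2)
      (≡.trans (cong (λ i → (x Mod.^ i) % ℓ′) (≡.trans (ℕₚ.*-comm r 2) (≡.sym h≡2r)))
        (reduce ℓ′ ℓ′∣q)))
    (-1-nonsquare ℓ′-prime ℓ′%4≡3 (x Mod.^ r))
    where module Mod = Modulo ℓ′
  -- For odd `h`, take the exponent `2 ^ m` as `k`: then `ℓ` is `suc (2 ^ k)`, and Fermat's theorem
  -- for `- x` is the hypothesis needed.
  ... | r , inj₂ h≡1+2r = x^odd≈-1⇒x≈-1 ring (2 ℕ.^ m) r x
    (≡.trans
      (cong (λ i → ((- x) ^ i) % ℓ)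
        (≡.trans (ℕₚ.+-comm 1 (2 ℕ.^ (2 ℕ.^ m))) (≡.sym ℓ≡2^2^m+1)))
      (fermat ℓ-prime (- x)))
    (≡.trans (cong (λ i → (x ^ i) % ℓ) (≡.sym h≡1+2r)) (reduce ℓ ℓ∣q))

  no-difference-1 : ∀ i j → ¬ a ℤ/pq.^ i ≡ (a ℤ/pq.^ j) ℤ/pq.+ ℤ/pq.1#
  -- The bound is 3 < 5 ≤ ℓ, so 3 is nonzero modulo `ℓ`. Modulo the Fermat prime 3 this would fail,
  -- since there -1 = 1 + 1.
  no-difference-1 i j aⁱ≡aʲ+1 = ≉0 (ℕₚ.<-≤-trans (s<s (s<s (s<s z<s))) ℓ≥5)
    (±1≈±1+1⇒3≈0 ring (-1^n≈±1 ring x≈-1 i) (-1^n≈±1 ring x≈-1 j) xⁱ≈xʲ+1)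
    where
    open ≡.≡-Reasoning
    xⁱ≈xʲ+1 : x ^ i ≈ x ^ j ℕ.+ 1
    xⁱ≈xʲ+1 = begin
      x ^ i % ℓ                                     ≡⟨ toℕ-^ a i ⟨
      toℕ (a ℤ/pq.^ i) % ℓ                          ≡⟨ cong (λ z → toℕ z % ℓ) aⁱ≡aʲ+1 ⟩
      toℕ ((a ℤ/pq.^ j) ℤ/pq.+ ℤ/pq.1#) % ℓ         ≡⟨ toℕ-+1 (a ℤ/pq.^ j) ⟩
      (toℕ (a ℤ/pq.^ j) ℕ.+ 1) % ℓ                  ≡⟨ +-cong {toℕ (a ℤ/pq.^ j)} (toℕ-^ a j) refl ⟩
      (x ^ j ℕ.+ 1) % ℓ                             ∎

  empty : Empty (S p q a ∩ S p q a ℤ/pq.+1)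
  empty (y , y∈) with x∈p∩q⁻ (S p q a) _ y∈
  ... | y∈S , y∈S+1 with ∈S⁻ p q a y∈S | ∈-+1⁻ (S p q a) y∈S+1
  ... | i , y≡aⁱ | s , s∈S , y≡s+1 with ∈S⁻ p q a s∈S
  ... | j , s≡aʲ = no-difference-1 (toℕ i) (toℕ j)
    (≡.trans (≡.sym y≡aⁱ) (≡.trans y≡s+1 (cong (ℤ/pq._+ ℤ/pq.1#) s≡aʲ)))
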